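{- No randomized online algorithm for the Proportional Online Unbounded Knapsack Problem with Removal can have a (strict) competitive ratio in expectation of less than $6/5$.
   Context: Problem. An instance of the Online Unbounded Knapsack Problem with Removal is a finite sequence of items $I=(x_1,\dots,x_n)$, where an item $x=(w,v)$ has a weight $w(x)=w\in(0,1]$ and a value $v(x)=v\in\mathbb{R}_{>0}$. A solution is a finite multiset $S$ of items from $I$ (each item may appear arbitrarily often) with $\sum_{x\in S}w(x)\le 1$; its gain is $v(S)=\sum_{x\in S}v(x)$. $\mathrm{Opt}(I)$ denotes a solution to $I$ of maximum gain. In the proportional variant, every item satisfies $w(x)=v(x)$, and an item $x$ is identified with this number, $x=w(x)=v(x)\in(0,1]$. Online algorithms. An online algorithm maintains a solution $S$ ("knapsack"), initially empty. Items arrive one by one in order; when an item $x$ arrives, the algorithm, knowing only the items received so far (in particular not knowing the number of items or any future item), may add any number of copies of $x$ to $S$ and then remove an arbitrary sub-multiset from $S$, such that $S$ is again a valid solution. $\mathrm{Alg}(I)$ denotes the solution held by the algorithm after all of $I$ has been processed. A randomized online algorithm may base its decisions on random choices, i.e., it is a probability distribution over deterministic online algorithms; the instance is fixed independently of the random choices. Competitive ratio. A randomized algorithm Alg is (strictly) $c$-competitive in expectation, for a constant $c\ge 1$, if $c\cdot \mathbb{E}[v(\mathrm{Alg}(I))]\ge v(\mathrm{Opt}(I))$ for every instance $I$. Its (strict) competitive ratio in expectation is the infimum of all $c\ge1$ for which it is $c$-competitive in expectation (and $\infty$ if there is no such $c$). -}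

module Defs where

open import Algebra.Bundles using (CommutativeRing)
import Algebra.Definitions.RawMonoid as RawMonoidDefinitions
open import Algebra.Structures using (IsCommutativeRing)
open import Data.Bool.Base using (Bool; true; not)
open import Data.List.Base using (List; []; _++_; _∷ʳ_; map; foldr; replicate; applyUpTo)
open import Data.List.Membership.Propositional using (_∈_)
open import Data.List.Relation.Binary.Permutation.Propositional using (_↭_)
open import Data.List.Relation.Unary.All using (All)
open import Data.List.Relation.Unary.AllPairs using (AllPairs)
open import Data.Nat.Base using (ℕ)
open import Data.Product.Base using (_×_; _,_; ∃; ∃₂; ∃-syntax; proj₁; proj₂)
open import Function.Base using (_∘_; const; _on_)
open import Function.Bundles using (_⇔_)
open import Level using (0ℓ)
open import Relation.Binary.Core using (Rel)
import Relation.Binary.Construct.StrictToNonStrict as StrictToNonStrict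
import Relation.Binary.Construct.Add.Supremum.Strict as AddSupremum
open import Relation.Binary.PropositionalEquality.Core using (_≡_; _≢_)
open import Relation.Binary.Structures using (IsStrictTotalOrder)
open import Relation.Nullary using (¬_; does)
open import Relation.Nullary.Construct.Add.Supremum using (_⁺; [_]; ⊤⁺)
open import Relation.Unary using (Pred; Satisfiable)

module Bounds {A : Set} (_≤_ : Rel A 0ℓ) where

  UpperBound LowerBound : Pred A 0ℓ → Pred A 0ℓ
  UpperBound S u = ∀ {x} → S x → x ≤ u
  LowerBound S l = ∀ {x} → S x → l ≤ x

  IsSupremum IsInfimum : Pred A 0ℓ → Pred A 0ℓ
  IsSupremum S s = UpperBound S s × (∀ {u} → UpperBound S u → s ≤ u)
  IsInfimum  S i = LowerBound S i × (∀ {l} → LowerBound S l → l ≤ i)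

-- The classical axioms of the real numbers, which determine them up to
-- isomorphism.  Trichotomy makes the order decidable, as it is classically.
record RealNumbers : Set₁ where
  infix  4 _<_
  infixl 6 _+_
  infixl 7 _*_ _/_
  infix  8 -_ _⁻¹
  field
    ℝ                  : Set
    _<_                : Rel ℝ 0ℓ
    _+_ _*_            : ℝ → ℝ → ℝ
    -_                 : ℝ → ℝ
    0# 1#              : ℝ
    _⁻¹                : ℝ → ℝ  -- total, but the value at 0# is unspecified
    isCommutativeRing  : IsCommutativeRing _≡_ _+_ _*_ -_ 0# 1#
    0≢1                : 0# ≢ 1#
    ⁻¹-inverseʳ        : ∀ {x} → x ≢ 0# → x * x ⁻¹ ≡ 1#
    isStrictTotalOrder : IsStrictTotalOrder _≡_ _<_
    +-monoʳ-<          : ∀ x {y z} → y < z → x + y < x + z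
    *-pos              : ∀ {x y} → 0# < x → 0# < y → 0# < x * y

  open StrictToNonStrict _≡_ _<_ public using (_≤_)
  open Bounds _≤_ public

  field
    complete : (S : Pred ℝ 0ℓ) → Satisfiable S → Satisfiable (UpperBound S) →
               Satisfiable (IsSupremum S)

  commutativeRing : CommutativeRing 0ℓ 0ℓ
  commutativeRing = record { isCommutativeRing = isCommutativeRing }

  open IsStrictTotalOrder isStrictTotalOrder public using (_<?_)

  fromℕ : ℕ → ℝ
  fromℕ n = n · 1#
    where open RawMonoidDefinitions (CommutativeRing.+-rawMonoid commutativeRing)
            renaming (_×_ to _·_)

  _/_ : ℝ → ℝ → ℝ
  x / y = x * y ⁻¹

  sum : List ℝ → ℝ
  sum = foldr _+_ 0#

-- Subsets of Ω are given by their characteristic functions; classically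
-- every subset has one.
Event : Set → Set
Event Ω = Ω → Bool

module _ {Ω : Set} where

  Disjoint : Rel (Event Ω) 0ℓ
  Disjoint E F = ∀ ω → ¬ (E ω ≡ true × F ω ≡ true)

  _IsUnionOf_ : Event Ω → (ℕ → Event Ω) → Set
  F IsUnionOf E = ∀ ω → F ω ≡ true ⇔ (∃[ n ] E n ω ≡ true)

module Probability (R : RealNumbers) where
  open RealNumbers R

  record ProbabilityMeasure (Ω : Set) : Set₁ where
    field
      Measurable : Pred (Event Ω) 0ℓ
      Ω-closed   : Measurable (const true)
      ∁-closed   : ∀ {E} → Measurable E → Measurable (not ∘ E)
      ⋃-closed   : ∀ {E F} → (∀ n → Measurable (E n)) → F IsUnionOf E → Measurable F
      -- Only the values on measurable events matter.
      P          : Event Ω → ℝ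
      P-nonneg   : ∀ {E} → Measurable E → 0# ≤ P E
      P-Ω        : P (const true) ≡ 1#
      -- A series of nonnegative terms is the supremum of its partial sums.
      σ-additive : ∀ {E F} → (∀ n → Measurable (E n)) →
                   (∀ {m n} → m ≢ n → Disjoint (E m) (E n)) → F IsUnionOf E →
                   IsSupremum (λ s → ∃[ n ] s ≡ sum (applyUpTo (P ∘ E) n)) (P F)

  module _ {Ω : Set} (μ : ProbabilityMeasure Ω) where
    open ProbabilityMeasure μ

    MeasurableFunction : Pred (Ω → ℝ) 0ℓ
    MeasurableFunction X = ∀ t → Measurable (λ ω → does (t <? X ω))

    -- A list of pairs (aᵢ , Eᵢ) with the Eᵢ pairwise disjoint stands for the
    -- simple function with value aᵢ on Eᵢ and 0 off all of the Eᵢ.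
    SimpleFunction : Set
    SimpleFunction = List (ℝ × Event Ω)

    IsSimple : Pred SimpleFunction 0ℓ
    IsSimple φ = All (λ (a , E) → 0# ≤ a × Measurable E) φ
               × AllPairs (Disjoint on proj₂) φ

    -- For nonnegative X, this is φ ≤ X pointwise.
    _Below_ : SimpleFunction → (Ω → ℝ) → Set
    φ Below X = All (λ (a , E) → ∀ ω → E ω ≡ true → a ≤ X ω) φ

    simpleIntegral : SimpleFunction → ℝ
    simpleIntegral φ = sum (map (λ (a , E) → a * P E) φ)

    -- The Lebesgue integral of a nonnegative measurable function.
    IsExpectation : (Ω → ℝ) → ℝ → Set
    IsExpectation X =
      IsSupremum (λ s → ∃[ φ ] IsSimple φ × φ Below X × s ≡ simpleIntegral φ)

module ProportionalUnboundedKnapsack (R : RealNumbers) where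
  open RealNumbers R public
  open Probability R public
  open AddSupremum _<_ public using (_<⁺_)

  -- The size of an item is both its weight and its value.  The bounds are
  -- irrelevant so that items of the same size are equal.
  record Item : Set where
    field
      size       : ℝ
      .size-pos  : 0# < size
      .size-≤1   : size ≤ 1#
  open Item public

  Instance : Set
  Instance = List Item

  -- Considered up to permutation.
  Multiset : Set
  Multiset = List Item

  -- Both the total weight and the total value.
  gain : Multiset → ℝ
  gain S = sum (map size S)

  Fits : Pred Multiset 0ℓ
  Fits S = gain S ≤ 1#

  IsSolution : Instance → Pred Multiset 0ℓ
  IsSolution I S = All (_∈ I) S × Fits S

  IsOptimal : Instance → Pred Multiset 0ℓ
  IsOptimal I S = IsSolution I S × (∀ {T} → IsSolution I T → gain T ≤ gain S)

  -- On arrival of x, S becomes S′ by adding k copies of x and then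
  -- removing the sub-multiset D.
  Step : Item → Multiset → Multiset → Set
  Step x S S′ = ∃₂ λ k D → S′ ++ D ↭ S ++ replicate k x

  -- knapsack h is the content after the items h have arrived, in this order.
  record DeterministicAlgorithm : Set where
    field
      knapsack : List Item → Multiset
      initial  : knapsack [] ≡ []
      step     : ∀ h x → Step x (knapsack h) (knapsack (h ∷ʳ x))
      fits     : ∀ h → Fits (knapsack h)
  open DeterministicAlgorithm public

  gainOn : Instance → DeterministicAlgorithm → ℝ
  gainOn I A = gain (knapsack A I)

  record RandomizedAlgorithm : Set₁ where
    field
      distribution    : ProbabilityMeasure DeterministicAlgorithm
      gain-measurable : ∀ I → MeasurableFunction distribution (gainOn I)
  open RandomizedAlgorithm public

  IsExpectedGain : RandomizedAlgorithm → Instance → ℝ → Set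
  IsExpectedGain A I = IsExpectation (distribution A) (gainOn I)

  _IsCompetitiveFor_ : ℝ → RandomizedAlgorithm → Set
  c IsCompetitiveFor A =
    ∀ I Opt → IsOptimal I Opt → ∃[ e ] IsExpectedGain A I e × gain Opt ≤ c * e

  data IsCompetitiveRatio (A : RandomizedAlgorithm) : ℝ ⁺ → Set where
    finite   : ∀ {r} → IsInfimum (λ c → 1# ≤ c × c IsCompetitiveFor A) r →
               IsCompetitiveRatio A [ r ]
    infinite : (∀ c → 1# ≤ c → ¬ c IsCompetitiveFor A) →
               IsCompetitiveRatio A ⊤⁺

{-# OPTIONS --safe #-}
module Submission where

-- Offer x of size slightly below 2/3 and then y of size slightly above 1/3 with
-- x + y > 1, so that the knapsack holds copies of only one of them.  The next
-- item is x̄ = 1 - x or ȳ = 1 - y, and either way the optimum is 1.  The sizes are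
-- such that without x the item x̄ is useless: three items among y and x̄ overflow.
-- Without y the item ȳ is useless: two items among x and ȳ overflow.  Hence
-- every deterministic algorithm gains only about 2/3 on one of the two
-- instances, so the expected gains add up to about 5/3, and the smaller one is
-- at most about 5/6.

open import Defs
open import Algebra.Bundles using (CommutativeRing)
import Algebra.Definitions.RawMonoid as RawMonoidDefinitions
import Algebra.Properties.AbelianGroup as AbelianGroupProperties
import Algebra.Properties.Group as GroupProperties
import Algebra.Properties.Ring as RingProperties
import Algebra.Solver.Ring.NaturalCoefficients.Default as NaturalCoefficientsSolver
open import Data.Bool.Base using (true; false; not; _∧_; _∨_)
open import Data.List.Base using ([]; _∷_; applyUpTo)
open import Data.List.Relation.Binary.Permutation.Propositional using (↭-sym)
open import Data.List.Relation.Binary.Permutation.Propositional.Properties using (All-resp-↭)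
open import Data.List.Relation.Unary.All as All using (All; []; _∷_)
import Data.List.Relation.Unary.All.Properties as All
open import Data.List.Relation.Unary.AllPairs using ([]; _∷_)
open import Data.List.Relation.Unary.Any using (here; there)
open import Data.Nat.Base using (ℕ; zero; suc)
open import Data.Product.Base using (_×_; _,_; proj₁; proj₂; ∃-syntax)
open import Data.Sum.Base using (_⊎_; inj₁; inj₂)
import Data.Sum.Base as Sum
open import Function.Base using (_∘_; const)
open import Function.Bundles using (mk⇔)
open import Level using (0ℓ)
open import Relation.Binary.Bundles using (StrictPartialOrder)
open import Relation.Binary.Definitions using (tri<; tri≈; tri>)
import Relation.Binary.Construct.Add.Supremum.Strict as AddSupremum
import Relation.Binary.Construct.StrictToNonStrict as StrictToNonStrict
import Relation.Binary.Reasoning.StrictPartialOrder as StrictPartialOrderReasoning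
open import Relation.Binary.PropositionalEquality
open import Relation.Binary.Structures using (IsStrictTotalOrder; IsTotalOrder)
open import Relation.Nullary using (¬_; yes; no; does; contradiction)
open import Relation.Nullary.Construct.Add.Supremum using ([_])
open import Relation.Nullary.Decidable using (recompute)
open import Relation.Unary using (Pred)

-- Arithmetic and order of the real numbers.

module RealProperties (R : RealNumbers) where
  open RealNumbers R
  open CommutativeRing commutativeRing public
    using (+-identityˡ; +-identityʳ; +-comm; +-assoc; -‿inverseʳ; *-comm;
           *-identityˡ; zeroʳ; distribˡ)
  open CommutativeRing commutativeRing
    using (ring; +-group; +-rawMonoid; commutativeSemiring)
  open RingProperties ring using (-‿distribˡ-*)
  open GroupProperties +-group public using () renaming (∙-cancelʳ to +-cancelʳ)
  open GroupProperties +-group using (⁻¹-involutive)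
  open NaturalCoefficientsSolver commutativeSemiring public
    using (solve; Polynomial; con; _:+_; _:*_; _:=_)
  open RawMonoidDefinitions +-rawMonoid public using () renaming (_×_ to _·_)
  open IsStrictTotalOrder isStrictTotalOrder public using (compare)
    renaming (trans to <-trans; irrefl to <-irrefl; asym to <-asym)
  open IsStrictTotalOrder isStrictTotalOrder using (isStrictPartialOrder)
  open IsTotalOrder (StrictToNonStrict.isTotalOrder _≡_ _<_ isStrictTotalOrder) public
    using () renaming (antisym to ≤-antisym; trans to ≤-trans)

  strictPartialOrder : StrictPartialOrder _ _ _
  strictPartialOrder = record { isStrictPartialOrder = isStrictPartialOrder }

  module ≤-Reasoning = StrictPartialOrderReasoning strictPartialOrder
  open ≤-Reasoning

  infixr 9 _:·_
  -- This follows the recursion of `_·_`, so that `k :· p` denotes the iterated sum `k · x` itself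
  -- and solved equations match the goals by `refl`.
  _:·_ : ∀ {n} → ℕ → Polynomial n → Polynomial n
  zero  :· p = con 0
  suc k :· p = p :+ k :· p

  ≤-refl : ∀ {x} → x ≤ x
  ≤-refl = inj₂ refl

  ≮⇒≥ : ∀ {x y} → ¬ x < y → y ≤ x
  ≮⇒≥ {x} {y} x≮y with compare x y
  ... | tri< x<y _ _ = contradiction x<y x≮y
  ... | tri≈ _ x≡y _ = inj₂ (sym x≡y)
  ... | tri> _ _ y<x = inj₁ y<x

  <⇒≱ : ∀ {x y} → x < y → ¬ y ≤ x
  <⇒≱ x<y (inj₁ y<x) = <-asym x<y y<x
  <⇒≱ x<y (inj₂ y≡x) = <-irrefl (sym y≡x) x<y

  ≰⇒> : ∀ {x y} → ¬ y ≤ x → x < y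
  ≰⇒> {x} {y} y≰x with x <? y
  ... | yes x<y = x<y
  ... | no x≮y  = contradiction (≮⇒≥ x≮y) y≰x

  ≤-<-trans : ∀ {x y z} → x ≤ y → y < z → x < z
  ≤-<-trans x≤y y<z = ≰⇒> λ z≤x → <⇒≱ y<z (≤-trans z≤x x≤y)

  +-monoʳ-≤ : ∀ x {y z} → y ≤ z → x + y ≤ x + z
  +-monoʳ-≤ x (inj₁ y<z)  = inj₁ (+-monoʳ-< x y<z)
  +-monoʳ-≤ x (inj₂ refl) = ≤-refl

  +-monoˡ-≤ : ∀ z {x y} → x ≤ y → x + z ≤ y + z
  +-monoˡ-≤ z {x} {y} x≤y = subst₂ _≤_ (+-comm z x) (+-comm z y) (+-monoʳ-≤ z x≤y)

  +-mono-≤ : ∀ {x y u v} → x ≤ y → u ≤ v → x + u ≤ y + v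
  +-mono-≤ {y = y} {u} x≤y u≤v = ≤-trans (+-monoˡ-≤ u x≤y) (+-monoʳ-≤ y u≤v)

  +-cancelˡ-≤ : ∀ x {y z} → x + y ≤ x + z → y ≤ z
  +-cancelˡ-≤ x x+y≤x+z = ≮⇒≥ λ z<y → <⇒≱ (+-monoʳ-< x z<y) x+y≤x+z

  +-nonneg : ∀ {x y} → 0# ≤ x → 0# ≤ y → 0# ≤ x + y
  +-nonneg {x} {y} 0≤x 0≤y = begin
    0#       ≡⟨ +-identityˡ 0# ⟨
    0# + 0#  ≤⟨ +-mono-≤ 0≤x 0≤y ⟩
    x + y    ∎

  +-posˡ : ∀ {x y} → 0# < x → 0# ≤ y → 0# < x + y
  +-posˡ {x} {y} 0<x 0≤y = begin-strict
    0#      <⟨ 0<x ⟩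
    x       ≡⟨ +-identityʳ x ⟨
    x + 0#  ≤⟨ +-monoʳ-≤ x 0≤y ⟩
    x + y   ∎

  ·-nonneg : ∀ n {x} → 0# ≤ x → 0# ≤ n · x
  ·-nonneg zero    0≤x = ≤-refl
  ·-nonneg (suc n) 0≤x = +-nonneg 0≤x (·-nonneg n 0≤x)

  ·-pos : ∀ n {x} → 0# < x → 0# < suc n · x
  ·-pos n 0<x = +-posˡ 0<x (·-nonneg n (inj₁ 0<x))

  ·-monoʳ-≤ : ∀ n {x y} → x ≤ y → n · x ≤ n · y
  ·-monoʳ-≤ zero    x≤y = ≤-refl
  ·-monoʳ-≤ (suc n) x≤y = +-mono-≤ x≤y (·-monoʳ-≤ n x≤y)

  gap⇒≤ : ∀ {x y} d → 0# ≤ d → x + d ≡ y → x ≤ y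
  gap⇒≤ {x} d 0≤d refl = subst (_≤ x + d) (+-identityʳ x) (+-monoʳ-≤ x 0≤d)

  gap⇒< : ∀ {x y} d → 0# < d → x + d ≡ y → x < y
  gap⇒< {x} d 0<d refl = subst (_< x + d) (+-identityʳ x) (+-monoʳ-< x 0<d)

  x+[y-x]≡y : ∀ x y → x + (y + - x) ≡ y
  x+[y-x]≡y x y = begin-equality
    x + (y + - x)  ≡⟨ solve 3 (λ x y m → x :+ (y :+ m) := y :+ (x :+ m)) refl x y (- x) ⟩
    y + (x + - x)  ≡⟨ cong (y +_) (-‿inverseʳ x) ⟩
    y + 0#         ≡⟨ +-identityʳ y ⟩
    y              ∎

  x<y⇒0<y-x : ∀ {x y} → x < y → 0# < y + - x
  x<y⇒0<y-x {x} {y} x<y =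
    subst₂ _<_ (trans (+-comm (- x) x) (-‿inverseʳ x)) (+-comm (- x) y) (+-monoʳ-< (- x) x<y)

  *-nonneg : ∀ {x y} → 0# ≤ x → 0# ≤ y → 0# ≤ x * y
  *-nonneg         (inj₁ 0<x)  (inj₁ 0<y)  = inj₁ (*-pos 0<x 0<y)
  *-nonneg {x}     _           (inj₂ refl) = inj₂ (sym (zeroʳ x))
  *-nonneg {y = y} (inj₂ refl) _           = inj₂ (sym (trans (*-comm 0# y) (zeroʳ y)))

  *-monoʳ-≤ : ∀ {x y z} → 0# ≤ x → y ≤ z → x * y ≤ x * z
  *-monoʳ-≤         0≤x (inj₂ refl) = ≤-refl
  *-monoʳ-≤ {x} {y} {z} 0≤x (inj₁ y<z) =
    gap⇒≤ (x * (z + - y)) (*-nonneg 0≤x (inj₁ (x<y⇒0<y-x y<z)))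
      (trans (sym (distribˡ x y (z + - y))) (cong (x *_) (x+[y-x]≡y y z)))

  *-monoˡ-≤ : ∀ {x y z} → 0# ≤ z → x ≤ y → x * z ≤ y * z
  *-monoˡ-≤ {x} {y} {z} 0≤z x≤y =
    subst₂ _≤_ (*-comm z x) (*-comm z y) (*-monoʳ-≤ 0≤z x≤y)

  -- If `1#` were negative, `- 1#` would be positive, and so would its square, which is `1#` again.
  0<1 : 0# < 1#
  0<1 with compare 0# 1#
  ... | tri< 0<1 _ _ = 0<1
  ... | tri≈ _ 0≡1 _ = contradiction 0≡1 0≢1
  ... | tri> _ _ 1<0 = subst (0# <_) [-1][-1]≡1 (*-pos 0<-1 0<-1)
    where
    0<-1 : 0# < - 1#
    0<-1 = subst (0# <_) (+-identityˡ (- 1#)) (x<y⇒0<y-x 1<0)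
    [-1][-1]≡1 : - 1# * - 1# ≡ 1#
    [-1][-1]≡1 = begin-equality
      - 1# * - 1#    ≡⟨ -‿distribˡ-* 1# (- 1#) ⟨
      - (1# * - 1#)  ≡⟨ cong -_ (*-identityˡ (- 1#)) ⟩
      - (- 1#)       ≡⟨ ⁻¹-involutive 1# ⟩
      1#             ∎

  0<fromℕ : ∀ n → 0# < fromℕ (suc n)
  0<fromℕ n = ·-pos n 0<1

  fromℕ-inverse : ∀ n → fromℕ (suc n) * fromℕ (suc n) ⁻¹ ≡ 1#
  fromℕ-inverse n = ⁻¹-inverseʳ λ n≡0 → <-irrefl (sym n≡0) (0<fromℕ n)

  fromℕ-⁻¹-pos : ∀ n → 0# < fromℕ (suc n) ⁻¹
  fromℕ-⁻¹-pos n = ≰⇒> λ q≤0 → <⇒≱ 0<1 (begin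
    1#                                ≡⟨ fromℕ-inverse n ⟨
    fromℕ (suc n) * fromℕ (suc n) ⁻¹  ≤⟨ *-monoʳ-≤ (inj₁ (0<fromℕ n)) q≤0 ⟩
    fromℕ (suc n) * 0#                ≡⟨ zeroʳ _ ⟩
    0#                                ∎)

-- Finite additivity and upper bounds for expectations.

module MeasureProperties (R : RealNumbers) {Ω : Set}
  (μ : Probability.ProbabilityMeasure R Ω) where

  open RealNumbers R
  open RealProperties R
  open Probability R
  open ProbabilityMeasure μ
  open ≤-Reasoning

  infixr 6 _∩_
  infixl 6 _∖_
  infix  4 _⊆_

  _∩_ _∖_ : Event Ω → Event Ω → Event Ω
  (E ∩ F) ω = E ω ∧ F ω
  (E ∖ F) ω = E ω ∧ not (F ω)

  _⊆_ : Event Ω → Event Ω → Set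
  E ⊆ F = ∀ ω → E ω ≡ true → F ω ≡ true

  ∅ : Event Ω
  ∅ = const false

  ∅-measurable : Measurable ∅
  ∅-measurable = ∁-closed Ω-closed

  -- The measure axioms speak of sequences of events, so a union of two events is padded with empty
  -- ones.
  pair : Event Ω → Event Ω → ℕ → Event Ω
  pair A B zero          = A
  pair A B (suc zero)    = B
  pair A B (suc (suc _)) = ∅

  pair-measurable : ∀ {A B} → Measurable A → Measurable B → ∀ n → Measurable (pair A B n)
  pair-measurable mA mB zero          = mA
  pair-measurable mA mB (suc zero)    = mB
  pair-measurable mA mB (suc (suc _)) = ∅-measurable

  pair-disjoint : ∀ {A B} → Disjoint A B →
                  ∀ {m n} → m ≢ n → Disjoint (pair A B m) (pair A B n)
  pair-disjoint A∥B {zero}        {zero}        m≢n _ _           = m≢n refl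
  pair-disjoint A∥B {zero}        {suc zero}    _   ω (a , b)     = A∥B ω (a , b)
  pair-disjoint A∥B {zero}        {suc (suc _)} _   _ (_ , ())
  pair-disjoint A∥B {suc zero}    {zero}        _   ω (b , a)     = A∥B ω (a , b)
  pair-disjoint A∥B {suc zero}    {suc zero}    m≢n _ _           = m≢n refl
  pair-disjoint A∥B {suc zero}    {suc (suc _)} _   _ (_ , ())
  pair-disjoint A∥B {suc (suc _)} {_}           _   _ (() , _)

  pair-union : ∀ {A B F} → (∀ ω → F ω ≡ A ω ∨ B ω) → F IsUnionOf pair A B
  pair-union {A} {B} {F} F≡A∨B ω rewrite F≡A∨B ω = mk⇔ to from
    where
    to : A ω ∨ B ω ≡ true → ∃[ n ] pair A B n ω ≡ true
    to eq with A ω in a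
    ... | true  = 0 , a
    ... | false = 1 , eq
    from : ∃[ n ] pair A B n ω ≡ true → A ω ∨ B ω ≡ true
    from (zero        , a) rewrite a = refl
    from (suc zero    , b) with A ω
    ... | true  = refl
    ... | false = b

  ∩-measurable : ∀ {E F} → Measurable E → Measurable F → Measurable (E ∩ F)
  ∩-measurable {E} {F} mE mF =
    -- De Morgan's law yields an event that agrees with `E ∩ F` only pointwise. Taking the union of
    -- that event with itself carries measurability over.
    ⋃-closed (pair-measurable m m) (pair-union λ ω → deMorgan (E ω) (F ω))
    where
    m : Measurable (not ∘ λ ω → not (E ω) ∨ not (F ω))
    m = ∁-closed (⋃-closed (pair-measurable (∁-closed mE) (∁-closed mF)) (pair-union λ _ → refl))
    deMorgan : ∀ e f → e ∧ f ≡ not (not e ∨ not f) ∨ not (not e ∨ not f)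
    deMorgan true  true  = refl
    deMorgan true  false = refl
    deMorgan false _     = refl

  ∖-measurable : ∀ {E F} → Measurable E → Measurable F → Measurable (E ∖ F)
  ∖-measurable mE mF = ∩-measurable mE (∁-closed mF)

  -- An empty event is the disjoint union of copies of itself, so that 2 · P E ≤ P E.
  P-empty : ∀ {E} → Measurable E → (∀ ω → E ω ≡ false) → P E ≡ 0#
  P-empty {E} mE E≡∅ = ≤-antisym (+-cancelˡ-≤ (P E) 2PE≤PE) (P-nonneg mE)
    where
    E≢true : ∀ {ω} → E ω ≢ true
    E≢true {ω} eq with () ← trans (sym (E≡∅ ω)) eq
    2PE≤PE : P E + P E ≤ P E + 0#
    2PE≤PE = begin
      P E + P E         ≡⟨ cong (P E +_) (+-identityʳ (P E)) ⟨
      P E + (P E + 0#)  ≤⟨ proj₁ (σ-additive {const E} (λ _ → mE)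
                             (λ _ _ (e , _) → E≢true e)
                             (λ _ → mk⇔ (0 ,_) proj₂)) (2 , refl) ⟩
      P E               ≡⟨ +-identityʳ (P E) ⟨
      P E + 0#          ∎

  -- As `P ∅` vanishes, the partial sums of the padded sequence are `0#`, `P A` and from then on
  -- `P A + P B`, so the sum with two terms is already the supremum.
  P-additive : ∀ {A B F} → Measurable A → Measurable B → Disjoint A B →
               (∀ ω → F ω ≡ A ω ∨ B ω) → P F ≡ P A + P B
  P-additive {A} {B} {F} mA mB A∥B F≡A∨B =
    ≤-antisym (least upper)
      (subst (_≤ P F) (cong (P A +_) (+-identityʳ (P B))) (bound (2 , refl)))
    where
    sup : IsSupremum (λ s → ∃[ n ] s ≡ sum (applyUpTo (P ∘ pair A B) n)) (P F)
    sup = σ-additive (pair-measurable mA mB) (pair-disjoint A∥B) (pair-union F≡A∨B)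
    bound = proj₁ sup
    least = proj₂ sup
    zeros : ∀ n → sum (applyUpTo (λ _ → P ∅) n) ≡ 0#
    zeros zero    = refl
    zeros (suc n) = trans (cong₂ _+_ (P-empty ∅-measurable (λ _ → refl)) (zeros n)) (+-identityʳ 0#)
    0≤PB : 0# ≤ P B
    0≤PB = P-nonneg mB
    upper : UpperBound (λ s → ∃[ n ] s ≡ sum (applyUpTo (P ∘ pair A B) n)) (P A + P B)
    upper (zero        , refl) = +-nonneg (P-nonneg mA) 0≤PB
    upper (suc zero    , refl) = +-monoʳ-≤ (P A) 0≤PB
    upper (suc (suc n) , refl) = inj₂ (cong (P A +_)
      (trans (cong (P B +_) (zeros n)) (+-identityʳ (P B))))

  ∩-∖-disjoint : ∀ E F → Disjoint (E ∩ F) (E ∖ F)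
  ∩-∖-disjoint E F ω (p , q) with E ω | F ω
  ∩-∖-disjoint E F ω (p , ()) | true | true
  ∩-∖-disjoint E F ω (() , q) | true | false

  P-split : ∀ {E F} → Measurable E → Measurable F → P E ≡ P (E ∩ F) + P (E ∖ F)
  P-split {E} {F} mE mF =
    P-additive (∩-measurable mE mF) (∖-measurable mE mF) (∩-∖-disjoint E F)
      λ ω → cover (E ω) (F ω)
    where
    cover : ∀ e f → e ≡ (e ∧ f) ∨ (e ∧ not f)
    cover true  true  = refl
    cover true  false = refl
    cover false _     = refl

  P-∩-additive : ∀ {E G H} → Measurable E → Measurable G → Measurable H → E ⊆ G →
                 P (G ∩ H) ≡ P (E ∩ H) + P ((G ∖ E) ∩ H)
  P-∩-additive {E} {G} {H} mE mG mH E⊆G =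
    P-additive (∩-measurable mE mH) (∩-measurable (∖-measurable mG mE) mH) disjoint cover
    where
    disjoint : Disjoint (E ∩ H) ((G ∖ E) ∩ H)
    disjoint ω (p , q) with E ω | G ω
    disjoint ω (p , ()) | true | true
    disjoint ω (p , ()) | true | false
    cover : ∀ ω → G ω ∧ H ω ≡ (E ω ∧ H ω) ∨ ((G ω ∧ not (E ω)) ∧ H ω)
    cover ω with E ω in e | G ω in g | H ω
    ... | true  | true  | true  = refl
    ... | true  | true  | false = refl
    ... | true  | false | _     with () ← trans (sym g) (E⊆G ω e)
    ... | false | true  | true  = refl
    ... | false | true  | false = refl
    ... | false | false | _     = refl

  -- The hypothesis compares `x` with `y` only if `E` is inhabited. If `y < x`, then `E` must be
  -- empty and both products are `0#`.
  *P-mono : ∀ {E x y} → Measurable E → (∀ ω → E ω ≡ true → x ≤ y) → x * P E ≤ y * P E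
  *P-mono {E} {x} {y} mE x≤y with y <? x
  ... | no y≮x  = *-monoˡ-≤ (P-nonneg mE) (≮⇒≥ y≮x)
  ... | yes y<x = inj₂ (trans (vanish x) (sym (vanish y)))
    where
    E-empty : ∀ ω → E ω ≡ false
    E-empty ω with E ω in e
    ... | true  = contradiction (x≤y ω e) (<⇒≱ y<x)
    ... | false = refl
    vanish : ∀ z → z * P E ≡ 0#
    vanish z = trans (cong (z *_) (P-empty mE E-empty)) (zeroʳ z)

  -- The events of `φ` are cut out of `G` one at a time. Disjointness keeps the later ones inside
  -- what remains of `G`, and superadditivity pays for each cut.
  simpleIntegral-≤ : (ν : Event Ω → ℝ) → (∀ {G} → Measurable G → 0# ≤ ν G) →
    (∀ {E G} → Measurable E → Measurable G → E ⊆ G → ν E + ν (G ∖ E) ≤ ν G) →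
    ∀ {φ G} → Measurable G → IsSimple μ φ → All (λ (a , E) → a * P E ≤ ν E) φ →
    All (λ (a , E) → E ⊆ G) φ → simpleIntegral μ φ ≤ ν G
  simpleIntegral-≤ ν nonneg superadditive {[]} mG _ _ _ = nonneg mG
  simpleIntegral-≤ ν nonneg superadditive {(a , E) ∷ φ} {G} mG
    ((_ , mE) ∷ simple , E∥φ ∷ disjoint) (aPE≤νE ∷ bounds) (E⊆G ∷ φ⊆G) = begin
    a * P E + simpleIntegral μ φ  ≤⟨ +-mono-≤ aPE≤νE
      (simpleIntegral-≤ ν nonneg superadditive (∖-measurable mG mE) (simple , disjoint) bounds
        (All.zipWith (λ {(_ , F)} → remove {F}) (E∥φ , φ⊆G))) ⟩
    ν E + ν (G ∖ E)               ≤⟨ superadditive mE mG E⊆G ⟩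
    ν G                           ∎
    where
    remove : ∀ {F} → Disjoint E F × F ⊆ G → F ⊆ G ∖ E
    remove (E∥F , F⊆G) ω f with E ω in e
    ... | true  = contradiction (e , f) (E∥F ω)
    ... | false rewrite F⊆G ω f = refl

  -- An expectation is a supremum, so it suffices to bound each simple function below `X`. Each of
  -- its events is split along `H`, and its coefficient is compared with `u` on one piece and with
  -- `v` on the other.
  expectation-≤ : ∀ {X e u v H} → Measurable H → 0# ≤ u → 0# ≤ v →
    (∀ ω → H ω ≡ true → X ω ≤ u) → (∀ ω → H ω ≡ false → X ω ≤ v) →
    IsExpectation μ X e → e ≤ u * P H + v * P (not ∘ H)
  expectation-≤ {X} {_} {u} {v} {H} mH 0≤u 0≤v X≤u X≤v (_ , least) = least bound
    where
    ν : Event Ω → ℝ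
    -- The integral over `G` of the two-valued function that is `u` on `H` and `v` off `H`.
    ν G = u * P (G ∩ H) + v * P (G ∖ H)

    nonneg : ∀ {G} → Measurable G → 0# ≤ ν G
    nonneg mG = +-nonneg (*-nonneg 0≤u (P-nonneg (∩-measurable mG mH)))
                         (*-nonneg 0≤v (P-nonneg (∖-measurable mG mH)))

    superadditive : ∀ {E G} → Measurable E → Measurable G → E ⊆ G → ν E + ν (G ∖ E) ≤ ν G
    superadditive {E} {G} mE mG E⊆G
      rewrite P-∩-additive mE mG mH E⊆G | P-∩-additive mE mG (∁-closed mH) E⊆G =
      inj₂ (solve 6 (λ u v p q r s →
        (u :* p :+ v :* q) :+ (u :* r :+ v :* s) := u :* (p :+ r) :+ v :* (q :+ s))
        refl u v (P (E ∩ H)) (P (E ∖ H)) (P ((G ∖ E) ∩ H)) (P ((G ∖ E) ∖ H)))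

    ∧-true : ∀ {a b} → a ∧ b ≡ true → a ≡ true × b ≡ true
    ∧-true {true} b = refl , b

    not-true : ∀ {a} → not a ≡ true → a ≡ false
    not-true {false} _ = refl

    term : ∀ {a E} → 0# ≤ a × Measurable E → (∀ ω → E ω ≡ true → a ≤ X ω) → a * P E ≤ ν E
    term {a} {E} (_ , mE) a≤X = begin
      a * P E                          ≡⟨ cong (a *_) (P-split mE mH) ⟩
      a * (P (E ∩ H) + P (E ∖ H))      ≡⟨ distribˡ a _ _ ⟩
      a * P (E ∩ H) + a * P (E ∖ H)    ≤⟨ +-mono-≤
        (*P-mono (∩-measurable mE mH) λ ω q → let e , h = ∧-true q in
          ≤-trans (a≤X ω e) (X≤u ω h))
        (*P-mono (∖-measurable mE mH) λ ω q → let e , h = ∧-true q in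
          ≤-trans (a≤X ω e) (X≤v ω (not-true h))) ⟩
      ν E                              ∎

    bound : UpperBound (λ s → ∃[ φ ] IsSimple μ φ × (_Below_ μ φ X) × s ≡ simpleIntegral μ φ)
                       (ν (const true))
    bound (φ , simple , below , refl) =
      simpleIntegral-≤ ν nonneg superadditive Ω-closed simple
        (All.zipWith (λ {(a , E)} (p , q) → term {a} {E} p q) (proj₁ simple , below))
        (All.universal (λ _ _ _ → refl) φ)

  -- The event s < X certifies which of the two bounds holds.
  expectation-sum-≤ : ∀ {X Y s c d} → MeasurableFunction μ X → 0# ≤ s →
    (∀ ω → X ω ≤ 1#) → (∀ ω → Y ω ≤ 1#) → (∀ ω → X ω ≤ s ⊎ Y ω ≤ s) →
    IsExpectation μ X c → IsExpectation μ Y d → c + d ≤ 1# + s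
  expectation-sum-≤ {X} {Y} {s} {c} {d} mX 0≤s X≤1 Y≤1 X≤s⊎Y≤s eX eY = begin
    c + d                                          ≤⟨ +-mono-≤
      (expectation-≤ mH (inj₁ 0<1) 0≤s (λ ω _ → X≤1 ω) X≤s eX)
      (expectation-≤ mH 0≤s (inj₁ 0<1) Y≤s (λ ω _ → Y≤1 ω) eY) ⟩
    (1# * p + s * q) + (s * p + 1# * q)            ≡⟨ solve 3 (λ s p q →
      (con 1 :* p :+ s :* q) :+ (s :* p :+ con 1 :* q) := (con 1 :+ s) :* (p :+ q)) refl s p q ⟩
    (1# + s) * (p + q)                             ≡⟨ cong ((1# + s) *_) (P-split Ω-closed mH) ⟨
    (1# + s) * P (const true)                      ≡⟨ cong ((1# + s) *_) P-Ω ⟩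
    (1# + s) * 1#                                  ≡⟨ trans (*-comm (1# + s) 1#) (*-identityˡ (1# + s)) ⟩
    1# + s                                         ∎
    where
    H : Event Ω
    H ω = does (s <? X ω)
    mH = mX s
    p = P H
    q = P (not ∘ H)
    X≤s : ∀ ω → H ω ≡ false → X ω ≤ s
    X≤s ω h with no s≮X ← s <? X ω = ≮⇒≥ s≮X
    Y≤s : ∀ ω → H ω ≡ true → Y ω ≤ s
    Y≤s ω h with yes s<X ← s <? X ω | X≤s⊎Y≤s ω
    ... | inj₁ X≤s = contradiction X≤s (<⇒≱ s<X)
    ... | inj₂ Y≤s = Y≤s

-- Contents of a knapsack.

module KnapsackProperties (R : RealNumbers) where
  open ProportionalUnboundedKnapsack R
  open RealProperties R
  open ≤-Reasoning

  0≤size : ∀ x → 0# ≤ size x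
  -- The stored proof of positivity is irrelevant; it is recovered by deciding `0# < w`.
  0≤size record { size = w ; size-pos = 0<w } = inj₁ (recompute (0# <? w) 0<w)

  0≤gain : ∀ S → 0# ≤ gain S
  0≤gain []      = ≤-refl
  0≤gain (x ∷ S) = +-nonneg (0≤size x) (0≤gain S)

  -- Up to order, the new content is part of the old content together with copies of `x`.
  Step-All : ∀ {P : Pred Item 0ℓ} {x S S′} → Step x S S′ → All P S → P x → All P S′
  Step-All {S′ = S′} (k , D , S′++D↭S++xᵏ) pS px =
    All.++⁻ˡ S′ (All-resp-↭ (↭-sym S′++D↭S++xᵏ) (All.++⁺ pS (All.replicate⁺ k px)))

  -- One copy of each item already overfills the knapsack, so the first item has to agree with those
  -- behind it.
  incompatible⇒homogeneous : ∀ x y → 1# < size x + size y → ∀ S → Fits S →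
    All (λ z → z ≡ x ⊎ z ≡ y) S → All (_≡ x) S ⊎ All (_≡ y) S
  incompatible⇒homogeneous x y 1<x+y []      _    []       = inj₁ []
  incompatible⇒homogeneous x y 1<x+y (z ∷ S) fits (p ∷ ps) =
    extend p fits (incompatible⇒homogeneous x y 1<x+y S tail-fits ps)
    where
    tail-fits : Fits S
    tail-fits = ≤-trans (gap⇒≤ (size z) (0≤size z) (+-comm (gain S) (size z))) fits

    overfull : ∀ u v S → 1# < size u + size v → ¬ Fits (u ∷ v ∷ S)
    overfull u v S 1<u+v = <⇒≱ (begin-strict
      1#                          <⟨ 1<u+v ⟩
      size u + size v             ≤⟨ gap⇒≤ (gain S) (0≤gain S) (+-assoc _ _ _) ⟩
      size u + (size v + gain S)  ∎)

    extend : ∀ {z S} → z ≡ x ⊎ z ≡ y → Fits (z ∷ S) → All (_≡ x) S ⊎ All (_≡ y) S →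
             All (_≡ x) (z ∷ S) ⊎ All (_≡ y) (z ∷ S)
    extend (inj₁ z≡x)  _    (inj₁ xs)         = inj₁ (z≡x ∷ xs)
    extend (inj₂ z≡y)  _    (inj₂ ys)         = inj₂ (z≡y ∷ ys)
    -- An empty tail is homogeneous in either item, so the alternative may be switched here.
    extend (inj₁ z≡x)  _    (inj₂ [])         = inj₁ (z≡x ∷ [])
    extend (inj₂ z≡y)  _    (inj₁ [])         = inj₂ (z≡y ∷ [])
    extend {S = _ ∷ S} (inj₁ refl) fits (inj₂ (refl ∷ _)) = contradiction fits (overfull x y S 1<x+y)
    extend {S = _ ∷ S} (inj₂ refl) fits (inj₁ (refl ∷ _)) =
      contradiction fits (overfull y x S (subst (1# <_) (+-comm (size x) (size y)) 1<x+y))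

  _∈[_,_] : Item → ℝ → ℝ → Set
  x ∈[ l , u ] = l ≤ size x × size x ≤ u

  -- With every item at least `l`, a gain below `suc n · l` leaves room for at most `n` items, each
  -- worth at most `u`.
  gain-≤-count : ∀ l u n S → 0# ≤ u → All _∈[ l , u ] S →
                 gain S < suc n · l → gain S ≤ n · u
  gain-≤-count l u n       []      0≤u []                      _        = ·-nonneg n 0≤u
  gain-≤-count l u zero    (x ∷ S) 0≤u ((l≤x , _) ∷ _)         gain<l   =
    contradiction (+-mono-≤ l≤x (0≤gain S)) (<⇒≱ gain<l)
  gain-≤-count l u (suc n) (x ∷ S) 0≤u ((l≤x , x≤u) ∷ S∈[l,u]) gain<n·l =
    +-mono-≤ x≤u (gain-≤-count l u n S 0≤u S∈[l,u]
      (≰⇒> λ n·l≤gain → <⇒≱ gain<n·l (+-mono-≤ l≤x n·l≤gain)))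

-- The two hard instances.

module _ (R : RealNumbers) where
  open ProportionalUnboundedKnapsack R
  open RealProperties R
  open KnapsackProperties R
  open ≤-Reasoning

  -- The sizes are x = 2h + ε, y = h + 3ε, x̄ = 1 - x and ȳ = 1 - y.
  module HardInstances (h ε : ℝ)
    (0<ε : 0# < ε) (3ε<h : 3 · ε < h) (3h+3ε≡1 : 3 · h + 3 · ε ≡ 1#) where

    private
      0≤ε : 0# ≤ ε
      0≤ε = inj₁ 0<ε

      0<h : 0# < h
      0<h = <-trans (·-pos 2 0<ε) 3ε<h

      0≤h : 0# ≤ h
      0≤h = inj₁ 0<h

      -- The summand `k · h + l · ε` is the room left beside the item; being nonnegative, it
      -- witnesses that the size is at most `1#`. The coefficient `suc i` makes the size positive.
      item : ∀ i j k l → suc i · h + j · ε + (k · h + l · ε) ≡ 1# → Item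
      item i j k l total = record
        { size     = suc i · h + j · ε
        ; size-pos = +-posˡ (·-pos i 0<h) (·-nonneg j 0≤ε)
        ; size-≤1  = gap⇒≤ (k · h + l · ε) (+-nonneg (·-nonneg k 0≤h) (·-nonneg l 0≤ε)) total
        }

      total : ∀ {z} → z ≡ 3 · h + 3 · ε → z ≡ 1#
      total z≡ = trans z≡ 3h+3ε≡1

    x y x̄ ȳ : Item
    x = item 1 1 1 2 (total (solve 2 (λ h ε →
      2 :· h :+ 1 :· ε :+ (1 :· h :+ 2 :· ε) := 3 :· h :+ 3 :· ε) refl h ε))
    y = item 0 3 2 0 (total (solve 2 (λ h ε →
      1 :· h :+ 3 :· ε :+ (2 :· h :+ 0 :· ε) := 3 :· h :+ 3 :· ε) refl h ε))
    x̄ = item 0 2 2 1 (total (solve 2 (λ h ε →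
      1 :· h :+ 2 :· ε :+ (2 :· h :+ 1 :· ε) := 3 :· h :+ 3 :· ε) refl h ε))
    ȳ = item 1 0 1 3 (total (solve 2 (λ h ε →
      2 :· h :+ 0 :· ε :+ (1 :· h :+ 3 :· ε) := 3 :· h :+ 3 :· ε) refl h ε))

    Iˣ Iʸ : Instance
    Iˣ = x ∷ y ∷ x̄ ∷ []
    Iʸ = x ∷ y ∷ ȳ ∷ []

    -- The most that a wrong choice can gain. Since `3 · h + 3 · ε` is `1#`, its value is 2/3 + 4ε.
    s : ℝ
    s = 2 · size y

    full⇒optimal : ∀ {I S} → IsSolution I S → gain S ≡ 1# → IsOptimal I S
    full⇒optimal sol gain≡1 = sol , λ (_ , fits) → subst (_ ≤_) (sym gain≡1) fits

    gain-xx̄ : gain (x ∷ x̄ ∷ []) ≡ 1#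
    gain-xx̄ = total (solve 2 (λ h ε →
      (2 :· h :+ 1 :· ε) :+ ((1 :· h :+ 2 :· ε) :+ con 0) := 3 :· h :+ 3 :· ε) refl h ε)

    gain-yȳ : gain (y ∷ ȳ ∷ []) ≡ 1#
    gain-yȳ = total (solve 2 (λ h ε →
      (1 :· h :+ 3 :· ε) :+ ((2 :· h :+ 0 :· ε) :+ con 0) := 3 :· h :+ 3 :· ε) refl h ε)

    xx̄-optimal : IsOptimal Iˣ (x ∷ x̄ ∷ [])
    xx̄-optimal = full⇒optimal
      ((here refl ∷ there (there (here refl)) ∷ []) , inj₂ gain-xx̄) gain-xx̄

    yȳ-optimal : IsOptimal Iʸ (y ∷ ȳ ∷ [])
    yȳ-optimal = full⇒optimal
      ((there (here refl) ∷ there (there (here refl)) ∷ []) , inj₂ gain-yȳ) gain-yȳ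

    1<x+y : 1# < size x + size y
    1<x+y = gap⇒< ε 0<ε (trans (cong (_+ ε) (sym 3h+3ε≡1)) (solve 2 (λ h ε →
      3 :· h :+ 3 :· ε :+ ε := (2 :· h :+ 1 :· ε) :+ (1 :· h :+ 3 :· ε)) refl h ε))

    1<3x̄ : 1# < 3 · size x̄
    1<3x̄ = gap⇒< (3 · ε) (·-pos 2 0<ε) (trans (cong (_+ 3 · ε) (sym 3h+3ε≡1)) (solve 2 (λ h ε →
      3 :· h :+ 3 :· ε :+ 3 :· ε := 3 :· (1 :· h :+ 2 :· ε)) refl h ε))

    -- Two copies take up `4 · h`, which exceeds `3 · h + 3 · ε` because `3 · ε < h`.
    1<2ȳ : 1# < 2 · size ȳ
    1<2ȳ = begin-strict
      1#               ≡⟨ 3h+3ε≡1 ⟨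
      3 · h + 3 · ε    <⟨ +-monoʳ-< (3 · h) 3ε<h ⟩
      3 · h + h        ≡⟨ solve 2 (λ h ε → 3 :· h :+ h := 2 :· (2 :· h :+ 0 :· ε)) refl h ε ⟩
      2 · size ȳ       ∎

    x̄≤y : size x̄ ≤ size y
    x̄≤y = gap⇒≤ ε 0≤ε (solve 2 (λ h ε →
      (1 :· h :+ 2 :· ε) :+ ε := 1 :· h :+ 3 :· ε) refl h ε)

    ȳ≤x : size ȳ ≤ size x
    ȳ≤x = gap⇒≤ ε 0≤ε (solve 2 (λ h ε →
      (2 :· h :+ 0 :· ε) :+ ε := 2 :· h :+ 1 :· ε) refl h ε)

    1·x≤s : 1 · size x ≤ s
    1·x≤s = gap⇒≤ (5 · ε) (·-nonneg 5 0≤ε) (solve 2 (λ h ε →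
      1 :· (2 :· h :+ 1 :· ε) :+ 5 :· ε := 2 :· (1 :· h :+ 3 :· ε)) refl h ε)

    0≤s : 0# ≤ s
    0≤s = ·-nonneg 2 (0≤size y)

    module _ (A : DeterministicAlgorithm) where

      private
        S = knapsack A (x ∷ y ∷ [])

      S⊆xy : All (λ z → z ≡ x ⊎ z ≡ y) S
      S⊆xy = Step-All (step A (x ∷ []) y)
        (Step-All (step A [] x) (subst (All _) (sym (initial A)) []) (inj₁ refl)) (inj₂ refl)

      -- Once `x` is lost, all sizes held after `x̄` lie between those of `x̄` and `y`, so at most
      -- two items fit.
      all-y⇒gain-≤ : All (_≡ y) S → gainOn Iˣ A ≤ s
      all-y⇒gain-≤ ys =
        gain-≤-count (size x̄) (size y) 2 (knapsack A Iˣ) (0≤size y) sizes (≤-<-trans (fits A Iˣ) 1<3x̄)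
        where
        sizes : All _∈[ size x̄ , size y ] (knapsack A Iˣ)
        sizes = Step-All {P = _∈[ size x̄ , size y ]} (step A (x ∷ y ∷ []) x̄)
          (All.map (λ { refl → x̄≤y , ≤-refl }) ys) (≤-refl , x̄≤y)

      -- Once `y` is lost, all sizes held after `ȳ` lie between those of `ȳ` and `x`, so at most one
      -- item fits.
      all-x⇒gain-≤ : All (_≡ x) S → gainOn Iʸ A ≤ s
      all-x⇒gain-≤ xs = ≤-trans
        (gain-≤-count (size ȳ) (size x) 1 (knapsack A Iʸ) (0≤size x) sizes (≤-<-trans (fits A Iʸ) 1<2ȳ))
        1·x≤s
        where
        sizes : All _∈[ size ȳ , size x ] (knapsack A Iʸ)
        sizes = Step-All {P = _∈[ size ȳ , size x ]} (step A (x ∷ y ∷ []) ȳ)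
          (All.map (λ { refl → ȳ≤x , ≤-refl }) xs) (≤-refl , ȳ≤x)

      -- Both instances begin with `x` and `y`, so the same knapsack `S` precedes either third item.
      -- Copies of `x` alone spoil `Iʸ`, and copies of `y` alone spoil `Iˣ`.
      dilemma : gainOn Iˣ A ≤ s ⊎ gainOn Iʸ A ≤ s
      dilemma = Sum.swap (Sum.map all-x⇒gain-≤ all-y⇒gain-≤
        (incompatible⇒homogeneous x y 1<x+y S (fits A (x ∷ y ∷ [])) S⊆xy))

    -- An averaging argument in the manner of Yao: the competitive inequalities of the two instances
    -- are added, and `dilemma`, valid for each deterministic algorithm, limits the sum of the
    -- expected gains.
    competitive⇒≤ : ∀ {c} A → 0# ≤ c → c IsCompetitiveFor A → 1# + 1# ≤ c * (1# + s)
    competitive⇒≤ {c} A 0≤c competitive =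
      combine (competitive Iˣ (x ∷ x̄ ∷ []) xx̄-optimal) (competitive Iʸ (y ∷ ȳ ∷ []) yȳ-optimal)
      where
      open MeasureProperties R (distribution A)
      combine : ∃[ e ] IsExpectedGain A Iˣ e × gain (x ∷ x̄ ∷ []) ≤ c * e →
                ∃[ e ] IsExpectedGain A Iʸ e × gain (y ∷ ȳ ∷ []) ≤ c * e →
                1# + 1# ≤ c * (1# + s)
      combine (eˣ , isEˣ , 1≤ceˣ) (eʸ , isEʸ , 1≤ceʸ) = begin
        1# + 1#          ≤⟨ +-mono-≤ (subst (_≤ c * eˣ) gain-xx̄ 1≤ceˣ) (subst (_≤ c * eʸ) gain-yȳ 1≤ceʸ) ⟩
        c * eˣ + c * eʸ  ≡⟨ distribˡ c eˣ eʸ ⟨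
        c * (eˣ + eʸ)    ≤⟨ *-monoʳ-≤ 0≤c (expectation-sum-≤ {gainOn Iˣ} {gainOn Iʸ} {s}
          (gain-measurable A Iˣ) 0≤s (λ B → fits B Iˣ) (λ B → fits B Iʸ) dilemma isEˣ isEʸ) ⟩
        c * (1# + s)     ∎

  -- Choice of the parameters for a ratio below 6/5.

  -- For 1 ≤ c < 6/5, h and ε are chosen such that c = 6/5 - 3ε.
  module Parameters (c : ℝ) (1≤c : 1# ≤ c) (c<6/5 : c < fromℕ 6 / fromℕ 5) where

    ε h : ℝ
    ε = (fromℕ 6 / fromℕ 5 + - c) * (fromℕ 3) ⁻¹
    h = (fromℕ 3) ⁻¹ + - ε

    0<ε : 0# < ε
    0<ε = *-pos (x<y⇒0<y-x c<6/5) (fromℕ-⁻¹-pos 2)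

    3h+3ε≡1 : 3 · h + 3 · ε ≡ 1#
    3h+3ε≡1 = begin-equality
      3 · h + 3 · ε           ≡⟨ solve 2 (λ h ε →
        3 :· h :+ 3 :· ε := 3 :· con 1 :* (ε :+ h)) refl h ε ⟩
      fromℕ 3 * (ε + h)       ≡⟨ cong (fromℕ 3 *_) (x+[y-x]≡y ε _) ⟩
      fromℕ 3 * (fromℕ 3) ⁻¹  ≡⟨ fromℕ-inverse 2 ⟩
      1#                      ∎

    c+3ε≡6/5 : c + 3 · ε ≡ fromℕ 6 / fromℕ 5
    c+3ε≡6/5 = begin-equality
      c + 3 · ε                             ≡⟨ solve 3 (λ c d w →
        c :+ 3 :· (d :* w) := c :+ d :* (3 :· con 1 :* w)) refl c d w ⟩
      c + d * (fromℕ 3 * w)                 ≡⟨ cong (λ z → c + d * z) (fromℕ-inverse 2) ⟩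
      c + d * 1#                            ≡⟨ cong (c +_) (trans (*-comm d 1#) (*-identityˡ d)) ⟩
      c + d                                 ≡⟨ x+[y-x]≡y c _ ⟩
      fromℕ 6 / fromℕ 5                     ∎
      where
      d = fromℕ 6 / fromℕ 5 + - c
      w = (fromℕ 3) ⁻¹

    5[c+3ε]≡6 : fromℕ 5 * (c + 3 · ε) ≡ fromℕ 6
    5[c+3ε]≡6 = begin-equality
      fromℕ 5 * (c + 3 · ε)    ≡⟨ cong (fromℕ 5 *_) c+3ε≡6/5 ⟩
      fromℕ 5 * (fromℕ 6 * q)  ≡⟨ solve 3 (λ x y q →
        x :* (y :* q) := (x :* q) :* y) refl (fromℕ 5) (fromℕ 6) q ⟩
      fromℕ 5 * q * fromℕ 6    ≡⟨ cong (_* fromℕ 6) (fromℕ-inverse 4) ⟩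
      1# * fromℕ 6             ≡⟨ *-identityˡ (fromℕ 6) ⟩
      fromℕ 6                  ∎
      where q = (fromℕ 5) ⁻¹

    -- From `1 ≤ c` follows 15ε = 6 - 5c ≤ 1 = 3h + 3ε, whereas `h ≤ 3 · ε` would bound the right
    -- side by 12ε.
    3ε<h : 3 · ε < h
    3ε<h = ≰⇒> λ h≤3ε → <-irrefl refl (begin-strict
      fromℕ 6                                ≡⟨ solve 0 (6 :· con 1 := 5 :· con 1 :* con 1 :+ con 1) refl ⟩
      fromℕ 5 * 1# + 1#                      ≡⟨ cong (fromℕ 5 * 1# +_) 3h+3ε≡1 ⟨
      fromℕ 5 * 1# + (3 · h + 3 · ε)         ≤⟨ +-mono-≤ (*-monoʳ-≤ (inj₁ (0<fromℕ 4)) 1≤c)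
                                                  (+-monoˡ-≤ (3 · ε) (·-monoʳ-≤ 3 h≤3ε)) ⟩
      fromℕ 5 * c + (3 · (3 · ε) + 3 · ε)    <⟨ gap⇒< (3 · ε) (·-pos 2 0<ε) (solve 2 (λ c e →
        5 :· con 1 :* c :+ (3 :· e :+ e) :+ e := 5 :· con 1 :* (c :+ e)) refl c (3 · ε)) ⟩
      fromℕ 5 * (c + 3 · ε)                  ≡⟨ 5[c+3ε]≡6 ⟩
      fromℕ 6                                ∎)

    -- Replacing 6 by 6(3h + 3ε) in 5c = 6 - 15ε makes 5c a linear form in `h` and `ε`. To avoid
    -- subtraction, 15ε is added to both sides and cancelled.
    5c≡18h+3ε : fromℕ 5 * c ≡ 3 · (6 · h + ε)
    5c≡18h+3ε = +-cancelʳ (5 · (3 · ε)) _ _ (begin-equality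
      fromℕ 5 * c + 5 · (3 · ε)        ≡⟨ solve 2 (λ c e →
        5 :· con 1 :* c :+ 5 :· e := 5 :· con 1 :* (c :+ e)) refl c (3 · ε) ⟩
      fromℕ 5 * (c + 3 · ε)            ≡⟨ 5[c+3ε]≡6 ⟩
      6 · 1#                           ≡⟨ cong (6 ·_) 3h+3ε≡1 ⟨
      6 · (3 · h + 3 · ε)              ≡⟨ solve 2 (λ h ε →
        6 :· (3 :· h :+ 3 :· ε) := 3 :· (6 :· h :+ ε) :+ 5 :· (3 :· ε)) refl h ε ⟩
      3 · (6 · h + ε) + 5 · (3 · ε)    ∎)

    -- After multiplication by 5, every `1#` is replaced by `u`, which equals it, so that both sides
    -- become quadratic forms in `h` and `ε`. They differ by 3ε(h + 21ε), which is positive.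
    c[1+s]<2 : c * (1# + 2 · (1 · h + 3 · ε)) < 1# + 1#
    c[1+s]<2 = ≰⇒> λ 2≤c[1+s] → <-irrefl refl (begin-strict
      fromℕ 5 * (1# + 1#)              ≤⟨ *-monoʳ-≤ (inj₁ (0<fromℕ 4)) 2≤c[1+s] ⟩
      fromℕ 5 * (c * (1# + s))         ≡⟨ solve 3 (λ x y z →
        x :* (y :* z) := (x :* y) :* z) refl (fromℕ 5) c (1# + s) ⟩
      (fromℕ 5 * c) * (1# + s)         ≡⟨ cong₂ (λ v w → v * (w + s)) 5c≡18h+3ε (sym 3h+3ε≡1) ⟩
      (3 · (6 · h + ε)) * (u + s)      <⟨ gap⇒< (3 · (ε * (h + 3 · (7 · ε)))) 0<gap
        (solve 2 (λ h ε → let u = 3 :· h :+ 3 :· ε in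
          (3 :· (6 :· h :+ ε)) :* (u :+ 2 :· (1 :· h :+ 3 :· ε)) :+
            3 :· (ε :* (h :+ 3 :· (7 :· ε))) :=
          5 :· con 1 :* (u :* u :+ u :* u)) refl h ε) ⟩
      fromℕ 5 * (u * u + u * u)        ≡⟨ cong (λ z → fromℕ 5 * (z * z + z * z)) 3h+3ε≡1 ⟩
      fromℕ 5 * (1# * 1# + 1# * 1#)    ≡⟨ cong (λ z → fromℕ 5 * (z + z)) (*-identityˡ 1#) ⟩
      fromℕ 5 * (1# + 1#)              ∎)
      where
      s = 2 · (1 · h + 3 · ε)
      u = 3 · h + 3 · ε
      0<gap : 0# < 3 · (ε * (h + 3 · (7 · ε)))
      0<gap = ·-pos 2 (*-pos 0<ε (+-posˡ (<-trans (·-pos 2 0<ε) 3ε<h)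
        (·-nonneg 3 (·-nonneg 7 (inj₁ 0<ε)))))

  competitive⇒6/5≤ : ∀ A {c} → 1# ≤ c → c IsCompetitiveFor A → fromℕ 6 / fromℕ 5 ≤ c
  competitive⇒6/5≤ A {c} 1≤c competitive = ≮⇒≥ λ c<6/5 →
    let open Parameters c 1≤c c<6/5
        open HardInstances h ε 0<ε 3ε<h 3h+3ε≡1
    in <⇒≱ c[1+s]<2 (competitive⇒≤ A (≤-trans (inj₁ 0<1) 1≤c) competitive)

lemma4 : (R : RealNumbers) → let open ProportionalUnboundedKnapsack R in
    (A : RandomizedAlgorithm) →
    ¬ (∃[ ρ ] (IsCompetitiveRatio A ρ × ρ <⁺ [ fromℕ 6 / fromℕ 5 ]))
-- An infinite ratio is never below a finite one. In the finite case 6/5 is a lower bound of all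
-- admissible `c`, hence at most their infimum.
lemma4 R A (_ , ProportionalUnboundedKnapsack.finite (_ , greatest) , AddSupremum.[_] r<6/5) =
  <⇒≱ r<6/5 (greatest λ (1≤c , competitive) → competitive⇒6/5≤ R A 1≤c competitive)
  where open RealProperties R
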